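{- For any integers $k\ge 2$ and $t\ge 1$, there exists a colour-balanced $k$-edge-colouring of the complete bipartite graph $K_{kt,kt}$ with no colour-balanced perfect matching.
   Context: A $k$-edge-colouring is an arbitrary (not necessarily proper) map from the edge set to $[k]=\{1,\dots,k\}$; it is colour-balanced if all $k$ colour classes have the same size. A perfect matching is colour-balanced if each of the $k$ colours appears on equally many of its edges (here exactly $t$ each). $K_{kt,kt}$ is the complete bipartite graph with both parts of size $kt$. -}

module Defs where

open import Data.Bool using (Bool; true; T)
open import Data.Bool.Properties using (T?)
open import Data.Fin using (Fin; _≟_)
open import Data.List using (List; length; filter; allFin; cartesianProduct)
open import Data.Nat using (ℕ)
open import Data.Product using (_×_; _,_; ∃!)
open import Data.Sum using (_⊎_; inj₁; inj₂)
open import Relation.Binary.PropositionalEquality using (_≡_)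
open import Relation.Nullary.Decidable using (_×-dec_)

-- The complete bipartite graph K a b: its parts are Fin a and Fin b, and the
-- pair (i , j) is the edge joining inj₁ i to inj₂ j.

Vertex : ℕ → ℕ → Set
Vertex a b = Fin a ⊎ Fin b

Edge : ℕ → ℕ → Set
Edge a b = Fin a × Fin b

Incident : ∀ {a b} → Vertex a b → Edge a b → Set
Incident (inj₁ i) (i′ , _)  = i ≡ i′
Incident (inj₂ j) (_  , j′) = j ≡ j′

edges : ∀ a b → List (Edge a b)
edges a b = cartesianProduct (allFin a) (allFin b)

-- Subsets of the edge set, as characteristic functions.
EdgeSet : ℕ → ℕ → Set
EdgeSet a b = Edge a b → Bool

allEdges : ∀ {a b} → EdgeSet a b
allEdges _ = true

IsPerfectMatching : ∀ {a b} → EdgeSet a b → Set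
IsPerfectMatching {a} {b} M =
  (v : Vertex a b) → ∃! _≡_ λ (e : Edge a b) → T (M e) × Incident v e

EdgeColouring : ℕ → ℕ → ℕ → Set
EdgeColouring k a b = Edge a b → Fin k

-- The number of edges of S that have colour i; `edges` lists every edge once.
colourCount : ∀ {k a b} → EdgeColouring k a b → EdgeSet a b → Fin k → ℕ
colourCount {a = a} {b} c S i =
  length (filter (λ e → T? (S e) ×-dec (c e ≟ i)) (edges a b))

IsColourBalancedOn : ∀ {k a b} → EdgeColouring k a b → EdgeSet a b → Set
IsColourBalancedOn {k} c S = (i j : Fin k) → colourCount c S i ≡ colourCount c S j

IsColourBalanced : ∀ {k a b} → EdgeColouring k a b → Set
IsColourBalanced c = IsColourBalancedOn c allEdges

{-# OPTIONS --safe #-}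
module Submission where

-- Label the edge (i , j) by ⌊ j / t ⌋: every row of the k t × k t array then
-- holds each colour t times, and so does every perfect matching.  Now shift
-- all colours in the first row cyclically down by one.  The rows stay balanced, but
-- a perfect matching uses exactly one edge of the first row, so the sum of its
-- colours modulo k is one less than that of a balanced matching.

open import Defs
open import Data.Bool using (Bool; true; false; T; _∧_; if_then_else_)
open import Data.Bool.Properties using (T?)
open import Data.Fin
  using (Fin; zero; suc; toℕ; fromℕ; inject₁; combine; quotient; _↑ˡ_; _↑ʳ_; punchIn; _≟_)
open import Data.Fin.Properties using (toℕ-fromℕ; toℕ-inject₁; remQuot-combine; punchInᵢ≢i)
open import Data.List using (length; filter; tabulate; cartesianProduct; map; _++_)
open import Data.List.Properties using (filter-++; length-++; map-tabulate)
open import Data.Nat using (ℕ; zero; suc; _+_; _*_; _≤_; s≤s)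
open import Data.Nat.Divisibility using (divides; ∣1⇒≡1)
open import Data.Nat.Properties
  using (*-identityˡ; *-identityʳ; *-zeroʳ; *-comm; *-assoc; *-cancelʳ-≡; *-distribˡ-+;
         +-identityʳ; +-comm; +-assoc; +-cancelˡ-≡; +-*-semiring)
open import Data.Product using (_×_; _,_; proj₁; ∃-syntax; Σ-syntax)
open import Data.Sum using (inj₁; inj₂)
open import Function using (_∘_; id)
open import Relation.Binary.PropositionalEquality
open import Relation.Nullary using (¬_; contradiction; does)
open import Relation.Nullary.Decidable using (dec-true; dec-false; _×-dec_)
open import Relation.Unary using (Pred; Decidable)

open import Algebra.Properties.Semiring.Sum +-*-semiring
  using (sum; sum-syntax; sum-cong-≗; sum-replicate-zero; sum-init-last; sum-remove;
         ∑-distrib-+; ∑-comm; *-distribˡ-sum; *-distribʳ-sum)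

open ≡-Reasoning

-- Indicators and finite sums.

𝟙 : Bool → ℕ
𝟙 b = if b then 1 else 0

𝟙-∧ : ∀ a b → 𝟙 (a ∧ b) ≡ 𝟙 a * 𝟙 b
𝟙-∧ true  b = sym (*-identityˡ (𝟙 b))
𝟙-∧ false b = refl

∑-const : ∀ n x → ∑[ i < n ] x ≡ n * x
∑-const zero    x = refl
∑-const (suc n) x = cong (x +_) (∑-const n x)

∑-single : ∀ {n} (f : Fin n → ℕ) i → (∀ j → j ≢ i → f j ≡ 0) → sum f ≡ f i
∑-single {suc n} f i f≡0 = begin
  sum f                            ≡⟨ sum-remove f ⟩
  f i + ∑[ j < n ] f (punchIn i j) ≡⟨ cong (f i +_) (sum-cong-≗ λ j → f≡0 (punchIn i j) (punchInᵢ≢i i j)) ⟩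
  f i + ∑[ j < n ] 0               ≡⟨ cong (f i +_) (sum-replicate-zero n) ⟩
  f i + 0                          ≡⟨ +-identityʳ (f i) ⟩
  f i                              ∎

∑-𝟙-unique : ∀ {n} (b : Fin n → Bool) i → T (b i) → (∀ {j} → T (b j) → i ≡ j) →
             ∑[ j < n ] 𝟙 (b j) ≡ 1
∑-𝟙-unique b i bi unique = trans
  -- `does (T? (b j))` computes to `b j`, so `dec-false` yields `b j ≡ false` directly.
  (∑-single (𝟙 ∘ b) i λ j j≢i → cong 𝟙 (dec-false (T? (b j)) (j≢i ∘ sym ∘ unique)))
  (cong 𝟙 (dec-true (T? (b i)) bi))

∑-𝟙-≟ : ∀ {n} (i : Fin n) (f : Fin n → ℕ) → ∑[ j < n ] (𝟙 (does (i ≟ j)) * f j) ≡ f i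
∑-𝟙-≟ i f = begin
  sum (λ j → 𝟙 (does (i ≟ j)) * f j)
    ≡⟨ ∑-single _ i (λ j j≢i → cong (λ b → 𝟙 b * f j) (dec-false (i ≟ j) (j≢i ∘ sym))) ⟩
  𝟙 (does (i ≟ i)) * f i
    ≡⟨ cong (λ b → 𝟙 b * f i) (dec-true (i ≟ i) refl) ⟩
  1 * f i
    ≡⟨ *-identityˡ (f i) ⟩
  f i ∎

∑-++ : ∀ m {n} (f : Fin (m + n) → ℕ) →
       sum f ≡ ∑[ i < m ] f (i ↑ˡ n) + ∑[ j < n ] f (m ↑ʳ j)
∑-++ zero    f = refl
∑-++ (suc m) f = trans (cong (f zero +_) (∑-++ m (f ∘ suc))) (sym (+-assoc (f zero) _ _))

∑-combine : ∀ m {n} (f : Fin (m * n) → ℕ) →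
            sum f ≡ ∑[ i < m ] ∑[ j < n ] f (combine i j)
∑-combine zero        f = refl
∑-combine (suc m) {n} f =
  trans (∑-++ n f) (cong (∑[ j < n ] f (j ↑ˡ (m * n)) +_) (∑-combine m (f ∘ (n ↑ʳ_))))

-- The fibres of `quotient n` are `m` blocks of `n` consecutive indices. This serves both the colour
-- counts in a row and the label sum over a matching.
∑-quotient : ∀ m n (f : Fin m → ℕ) → ∑[ i < m * n ] f (quotient n i) ≡ n * sum f
∑-quotient m n f = begin
  ∑[ i < m * n ] f (quotient n i)                        ≡⟨ ∑-combine m (f ∘ quotient n) ⟩
  ∑[ i < m ] ∑[ j < n ] f (quotient n (combine i j))     ≡⟨ sum-cong-≗ (λ i → sum-cong-≗ λ j →
                                                              cong (f ∘ proj₁) (remQuot-combine {k = n} i j)) ⟩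
  ∑[ i < m ] ∑[ j < n ] f i                              ≡⟨ sum-cong-≗ (λ i → ∑-const n (f i)) ⟩
  ∑[ i < m ] (n * f i)                                   ≡⟨ *-distribˡ-sum n f ⟨
  n * sum f                                              ∎

-- List lengths as sums of indicators.

module _ {a} {A : Set a} {p} {P : Pred A p} (P? : Decidable P) where

  length-filter-tabulate : ∀ {n} (f : Fin n → A) →
    length (filter P? (tabulate f)) ≡ ∑[ i < n ] 𝟙 (does (P? (f i)))
  length-filter-tabulate {zero}  f = refl
  length-filter-tabulate {suc n} f with does (P? (f zero))
  ... | true  = cong suc (length-filter-tabulate (f ∘ suc))
  ... | false = length-filter-tabulate (f ∘ suc)

module _ {a b} {A : Set a} {B : Set b} {p} {P : Pred (A × B) p} (P? : Decidable P) where

  length-filter-cartesianProduct : ∀ {m n} (f : Fin m → A) (g : Fin n → B) →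
    length (filter P? (cartesianProduct (tabulate f) (tabulate g))) ≡
    ∑[ i < m ] ∑[ j < n ] 𝟙 (does (P? (f i , g j)))
  length-filter-cartesianProduct {zero}  f g = refl
  length-filter-cartesianProduct {suc m} {n} f g = begin
    length (filter P? (row ++ rest))                   ≡⟨ cong length (filter-++ P? row rest) ⟩
    length (filter P? row ++ filter P? rest)           ≡⟨ length-++ (filter P? row) ⟩
    length (filter P? row) + length (filter P? rest)   ≡⟨ cong₂ _+_ row-count (length-filter-cartesianProduct (f ∘ suc) g) ⟩
    ∑[ i < suc m ] ∑[ j < n ] 𝟙 (does (P? (f i , g j))) ∎
    where
    row  = map (f zero ,_) (tabulate g)
    rest = cartesianProduct (tabulate (f ∘ suc)) (tabulate g)
    row-count : length (filter P? row) ≡ ∑[ j < n ] 𝟙 (does (P? (f zero , g j)))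
    row-count = trans (cong (length ∘ filter P?) (map-tabulate g (f zero ,_)))
                      (length-filter-tabulate P? ((f zero ,_) ∘ g))

-- Sums over edges and colour counts.

∑ᴱ : ∀ {a b} → (Edge a b → ℕ) → ℕ
∑ᴱ {a} {b} f = ∑[ i < a ] ∑[ j < b ] f (i , j)

∑ᴱ-cong : ∀ {a b} {f g : Edge a b → ℕ} → f ≗ g → ∑ᴱ f ≡ ∑ᴱ g
∑ᴱ-cong f≗g = sum-cong-≗ λ i → sum-cong-≗ λ j → f≗g (i , j)

∑ᴱ-distrib-+ : ∀ {a b} (f g : Edge a b → ℕ) → ∑ᴱ (λ e → f e + g e) ≡ ∑ᴱ f + ∑ᴱ g
∑ᴱ-distrib-+ f g = trans
  (sum-cong-≗ λ i → ∑-distrib-+ (λ j → f (i , j)) (λ j → g (i , j)))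
  (∑-distrib-+ (λ i → sum (λ j → f (i , j))) _)

*-distribˡ-∑ᴱ : ∀ {a b} x (f : Edge a b → ℕ) → x * ∑ᴱ f ≡ ∑ᴱ (λ e → x * f e)
*-distribˡ-∑ᴱ x f = trans
  (*-distribˡ-sum x (λ i → sum (λ j → f (i , j))))
  (sum-cong-≗ λ i → *-distribˡ-sum x (λ j → f (i , j)))

∑-∑ᴱ-comm : ∀ {k a b} (f : Fin k → Edge a b → ℕ) →
            ∑[ x < k ] ∑ᴱ (f x) ≡ ∑ᴱ (λ e → ∑[ x < k ] f x e)
∑-∑ᴱ-comm f = trans
  (∑-comm λ x i → sum λ j → f x (i , j))
  (sum-cong-≗ λ i → ∑-comm λ x j → f x (i , j))

colourCount-∑ᴱ : ∀ {k a b} (c : EdgeColouring k a b) S x →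
                 colourCount c S x ≡ ∑ᴱ (λ e → 𝟙 (S e ∧ does (c e ≟ x)))
colourCount-∑ᴱ {a = a} {b} c S x =
  length-filter-cartesianProduct (λ e → T? (S e) ×-dec (c e ≟ x)) (id {A = Fin a}) (id {A = Fin b})

-- Double counting: after exchanging the sums, only the edge's own colour survives in the inner one.
-- Weight 1 gives the size of `S`, and `toℕ` the sum of its colours.
∑-colourCount : ∀ {k a b} (c : EdgeColouring k a b) S (f : Fin k → ℕ) →
                ∑[ x < k ] (colourCount c S x * f x) ≡ ∑ᴱ (λ e → 𝟙 (S e) * f (c e))
∑-colourCount {k} {a} {b} c S f = begin
  ∑[ x < k ] (colourCount c S x * f x)
    ≡⟨ sum-cong-≗ {k} (λ x → trans (*-comm (colourCount c S x) (f x))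
        (trans (cong (f x *_) (colourCount-∑ᴱ c S x)) (*-distribˡ-∑ᴱ {a} {b} (f x) _))) ⟩
  ∑[ x < k ] ∑ᴱ (λ e → f x * 𝟙 (S e ∧ does (c e ≟ x)))
    ≡⟨ ∑-∑ᴱ-comm (λ x e → f x * 𝟙 (S e ∧ does (c e ≟ x))) ⟩
  ∑ᴱ (λ e → ∑[ x < k ] (f x * 𝟙 (S e ∧ does (c e ≟ x))))
    ≡⟨ ∑ᴱ-cong (λ e → trans (sum-cong-≗ (regroup e)) (sym (*-distribˡ-sum {k} (𝟙 (S e)) _))) ⟩
  ∑ᴱ (λ e → 𝟙 (S e) * (∑[ x < k ] (𝟙 (does (c e ≟ x)) * f x)))
    ≡⟨ ∑ᴱ-cong (λ e → cong (𝟙 (S e) *_) (∑-𝟙-≟ (c e) f)) ⟩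
  ∑ᴱ (λ e → 𝟙 (S e) * f (c e)) ∎
  where
  regroup : ∀ e x → f x * 𝟙 (S e ∧ does (c e ≟ x)) ≡ 𝟙 (S e) * (𝟙 (does (c e ≟ x)) * f x)
  regroup e x = begin
    f x * 𝟙 (S e ∧ does (c e ≟ x))          ≡⟨ *-comm (f x) _ ⟩
    𝟙 (S e ∧ does (c e ≟ x)) * f x          ≡⟨ cong (_* f x) (𝟙-∧ (S e) _) ⟩
    𝟙 (S e) * 𝟙 (does (c e ≟ x)) * f x      ≡⟨ *-assoc (𝟙 (S e)) _ _ ⟩
    𝟙 (S e) * (𝟙 (does (c e ≟ x)) * f x)    ∎

-- Sums over a perfect matching.

module _ {a b} {M : EdgeSet a b} (perfect : IsPerfectMatching M) where

  ∑-matching-row : ∀ i → ∑[ j < b ] 𝟙 (M (i , j)) ≡ 1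
  ∑-matching-row i with perfect (inj₁ i)
  -- Incidence fixes the row, so uniqueness of the edge becomes uniqueness of its column.
  ... | (_ , j) , (Me , refl) , unique =
    ∑-𝟙-unique (λ j → M (i , j)) j Me λ Me′ → cong (λ (_ , j) → j) (unique (Me′ , refl))

  ∑-matching-column : ∀ j → ∑[ i < a ] 𝟙 (M (i , j)) ≡ 1
  ∑-matching-column j with perfect (inj₂ j)
  ... | (i , _) , (Me , refl) , unique =
    ∑-𝟙-unique (λ i → M (i , j)) i Me λ Me′ → cong proj₁ (unique (Me′ , refl))

  ∑ᴱ-matching-row : (f : Fin a → ℕ) → ∑ᴱ (λ (i , j) → 𝟙 (M (i , j)) * f i) ≡ sum f
  ∑ᴱ-matching-row f = sum-cong-≗ λ i → begin
    ∑[ j < b ] (𝟙 (M (i , j)) * f i)  ≡⟨ *-distribʳ-sum {b} (f i) _ ⟨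
    (∑[ j < b ] 𝟙 (M (i , j))) * f i  ≡⟨ cong (_* f i) (∑-matching-row i) ⟩
    1 * f i                           ≡⟨ *-identityˡ (f i) ⟩
    f i                               ∎

  ∑ᴱ-matching-column : (f : Fin b → ℕ) → ∑ᴱ (λ (i , j) → 𝟙 (M (i , j)) * f j) ≡ sum f
  ∑ᴱ-matching-column f = trans (∑-comm λ i j → 𝟙 (M (i , j)) * f j) (sum-cong-≗ λ j → begin
    ∑[ i < a ] (𝟙 (M (i , j)) * f j)  ≡⟨ *-distribʳ-sum {a} (f j) _ ⟨
    (∑[ i < a ] 𝟙 (M (i , j))) * f j  ≡⟨ cong (_* f j) (∑-matching-column j) ⟩
    1 * f j                           ≡⟨ *-identityˡ (f j) ⟩
    f j                               ∎)

-- The cyclic shift of the first row.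

cyclicPred : ∀ {n} → Fin (suc n) → Fin (suc n)
cyclicPred zero    = fromℕ _
cyclicPred (suc x) = inject₁ x

-- The shift only moves the last summand to the front.
∑-cyclicPred : ∀ {n} (f : Fin (suc n) → ℕ) → ∑[ x < suc n ] f (cyclicPred x) ≡ sum f
∑-cyclicPred f = trans (+-comm (f (fromℕ _)) _) (sym (sum-init-last f))

twist : ∀ {m n} → Fin m → Fin (suc n) → Fin (suc n)
twist zero    = cyclicPred
twist (suc _) = id

∑-twist : ∀ {m n} (i : Fin m) (f : Fin (suc n) → ℕ) → ∑[ x < suc n ] f (twist i x) ≡ sum f
∑-twist zero    f = ∑-cyclicPred f
∑-twist (suc _) f = refl

δ₀ : ∀ {m} → Fin m → ℕ
δ₀ zero    = 1
δ₀ (suc _) = 0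

∑-δ₀ : ∀ m → ∑[ i < suc m ] δ₀ i ≡ 1
∑-δ₀ m = ∑-single {suc m} δ₀ zero λ { zero 0≢0 → contradiction refl 0≢0 ; (suc _) _ → refl }

-- Marks the one case, first row and colour 0, where the shift jumps up to the largest colour
-- instead of descending.
wrap : ∀ {m n} → Fin m → Fin n → ℕ
wrap i x = δ₀ i * δ₀ x

-- The congruence `twist i x` = `x` - `δ₀ i` modulo `suc n`, arranged without subtraction, with the
-- multiple of the modulus explicit.
toℕ-twist : ∀ {m n} (i : Fin m) (x : Fin (suc n)) →
            toℕ (twist i x) + δ₀ i ≡ toℕ x + suc n * wrap i x
toℕ-twist {n = n} zero zero = begin
  toℕ (fromℕ n) + 1  ≡⟨ cong (_+ 1) (toℕ-fromℕ n) ⟩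
  n + 1              ≡⟨ +-comm n 1 ⟩
  suc n              ≡⟨ *-identityʳ (suc n) ⟨
  suc n * 1          ∎
toℕ-twist {n = n} zero (suc x) = begin
  toℕ (inject₁ x) + 1      ≡⟨ cong (_+ 1) (toℕ-inject₁ x) ⟩
  toℕ x + 1                ≡⟨ +-comm (toℕ x) 1 ⟩
  suc (toℕ x)              ≡⟨ +-identityʳ _ ⟨
  suc (toℕ x) + 0          ≡⟨ cong (suc (toℕ x) +_) (*-zeroʳ (suc n)) ⟨
  suc (toℕ x) + suc n * 0  ∎
toℕ-twist {n = n} (suc i) x = cong (toℕ x +_) (sym (*-zeroʳ (suc n)))

-- The colouring and its balance.

twistedColouring : ∀ {m} n t → EdgeColouring (suc n) m (suc n * t)
twistedColouring n t (i , j) = twist i (quotient t j)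

twistedColouring-balanced : ∀ {m} n t → IsColourBalanced (twistedColouring {m} n t)
twistedColouring-balanced {m} n t x y = trans (count x) (sym (count y))
  where
  c = twistedColouring {m} n t
  -- Each row contributes `t`: the blocks have length `t` and `twist i` permutes the colours. The
  -- right side does not mention `x`, which is what balance asks for.
  count : ∀ x → colourCount c allEdges x ≡ ∑[ i < m ] t
  count x = trans (colourCount-∑ᴱ c allEdges x) (sum-cong-≗ {m} λ i → begin
    ∑[ j < suc n * t ] 𝟙 (does (twist i (quotient t j) ≟ x))
      ≡⟨ ∑-quotient (suc n) t (λ q → 𝟙 (does (twist i q ≟ x))) ⟩
    t * (∑[ q < suc n ] 𝟙 (does (twist i q ≟ x)))
      ≡⟨ cong (t *_) (∑-twist i (λ q → 𝟙 (does (q ≟ x)))) ⟩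
    t * (∑[ q < suc n ] 𝟙 (does (q ≟ x)))
      ≡⟨ cong (t *_) (∑-single _ x (λ q q≢x → cong 𝟙 (dec-false (q ≟ x) q≢x))) ⟩
    t * 𝟙 (does (x ≟ x))
      ≡⟨ cong (λ b → t * 𝟙 b) (dec-true (x ≟ x) refl) ⟩
    t * 1
      ≡⟨ *-identityʳ t ⟩
    t ∎)

-- A balanced perfect matching forces a single colour.

module _ {n t m} {M : EdgeSet (suc m) (suc n * t)} (perfect : IsPerfectMatching M)
         (balanced : IsColourBalancedOn (twistedColouring n t) M) where

  private
    c = twistedColouring {suc m} n t
    s = ∑[ x < suc n ] toℕ x

    ∑ᴹ : (Edge (suc m) (suc n * t) → ℕ) → ℕ
    ∑ᴹ f = ∑ᴱ λ e → 𝟙 (M e) * f e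

    -- The colour before the shift; `c e` is `twist (proj₁ e) (α e)` by definition.
    α : Edge (suc m) (suc n * t) → Fin (suc n)
    α (i , j) = quotient t j

    w : Edge (suc m) (suc n * t) → ℕ
    w e = wrap (proj₁ e) (α e)

  -- Balance makes every colour count equal to that of the reference colour `zero`, which then
  -- factors out.
  ∑ᴹ-colour : ∀ f → ∑ᴹ (f ∘ c) ≡ colourCount c M zero * sum f
  ∑ᴹ-colour f = begin
    ∑ᴹ (f ∘ c)                                     ≡⟨ ∑-colourCount c M f ⟨
    ∑[ x < suc n ] (colourCount c M x * f x)       ≡⟨ sum-cong-≗ (λ x → cong (_* f x) (balanced x zero)) ⟩
    ∑[ x < suc n ] (colourCount c M zero * f x)    ≡⟨ *-distribˡ-sum (colourCount c M zero) f ⟨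
    colourCount c M zero * sum f                   ∎

  ∑-1≡#colours : ∑[ x < suc n ] 1 ≡ suc n
  ∑-1≡#colours = trans (∑-const (suc n) 1) (*-identityʳ (suc n))

  -- The size of `M` is computed twice, once by colours and once by columns.
  colourCount≡t : colourCount c M zero ≡ t
  colourCount≡t = *-cancelʳ-≡ _ _ (suc n) (begin
    colourCount c M zero * suc n               ≡⟨ cong (colourCount c M zero *_) ∑-1≡#colours ⟨
    colourCount c M zero * (∑[ x < suc n ] 1)  ≡⟨ ∑ᴹ-colour (λ _ → 1) ⟨
    ∑ᴹ (λ _ → 1)                               ≡⟨ ∑ᴱ-matching-column perfect (λ _ → 1) ⟩
    ∑[ j < suc n * t ] 1                       ≡⟨ ∑-quotient (suc n) t (λ _ → 1) ⟩
    t * (∑[ x < suc n ] 1)                     ≡⟨ cong (t *_) ∑-1≡#colours ⟩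
    t * suc n                                  ∎)

  ∑ᴹ-distrib-+ : ∀ f g → ∑ᴹ (λ e → f e + g e) ≡ ∑ᴹ f + ∑ᴹ g
  ∑ᴹ-distrib-+ f g = trans
    (∑ᴱ-cong λ e → *-distribˡ-+ (𝟙 (M e)) (f e) (g e))
    (∑ᴱ-distrib-+ (λ e → 𝟙 (M e) * f e) (λ e → 𝟙 (M e) * g e))

  ∑ᴹ-scale : ∀ x f → ∑ᴹ (λ e → x * f e) ≡ x * ∑ᴹ f
  ∑ᴹ-scale x f = trans
    (∑ᴱ-cong λ e → trans (sym (*-assoc (𝟙 (M e)) x (f e)))
      (trans (cong (_* f e) (*-comm (𝟙 (M e)) x)) (*-assoc x (𝟙 (M e)) (f e))))
    (sym (*-distribˡ-∑ᴱ x (λ e → 𝟙 (M e) * f e)))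

  -- Summing `toℕ-twist` over `M` gives `t * s` on both sides, plus 1 on the left and a multiple of
  -- `suc n` on the right. Cancelling shows that `suc n` divides 1.
  numberOfColours≡1 : suc n ≡ 1
  numberOfColours≡1 = ∣1⇒≡1 (divides (∑ᴹ w) (trans (+-cancelˡ-≡ (t * s) _ _ (begin
    t * s + 1
      ≡⟨ cong (λ r → r * s + 1) colourCount≡t ⟨
    colourCount c M zero * s + 1
      -- Here `t * s` comes from the balance of `M`; the 1 is its only edge in the first row.
      ≡⟨ cong₂ _+_ (∑ᴹ-colour toℕ) (trans (∑ᴱ-matching-row perfect δ₀) (∑-δ₀ m)) ⟨
    ∑ᴹ (toℕ ∘ c) + ∑ᴹ (δ₀ ∘ proj₁)
      ≡⟨ ∑ᴹ-distrib-+ (toℕ ∘ c) (δ₀ ∘ proj₁) ⟨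
    ∑ᴹ (λ e → toℕ (c e) + δ₀ (proj₁ e))
      ≡⟨ ∑ᴱ-cong (λ e → cong (𝟙 (M e) *_) (toℕ-twist (proj₁ e) (α e))) ⟩
    ∑ᴹ (λ e → toℕ (α e) + suc n * w e)
      ≡⟨ ∑ᴹ-distrib-+ (toℕ ∘ α) (λ e → suc n * w e) ⟩
    ∑ᴹ (toℕ ∘ α) + ∑ᴹ (λ e → suc n * w e)
      -- This second `t * s` comes from the columns instead: `M` meets each once, and each label
      -- belongs to `t` of them.
      ≡⟨ cong₂ _+_ (trans (∑ᴱ-matching-column perfect (toℕ ∘ quotient {suc n} t)) (∑-quotient (suc n) t toℕ))
                   (∑ᴹ-scale (suc n) w) ⟩
    t * s + suc n * ∑ᴹ w ∎))
    (*-comm (suc n) (∑ᴹ w))))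

theorem5p2 : (k t : ℕ) → 2 ≤ k → 1 ≤ t →
    Σ[ c ∈ EdgeColouring k (k * t) (k * t) ]
    (IsColourBalanced c ×
    ¬ (∃[ M ] (IsPerfectMatching M × IsColourBalancedOn c M)))
theorem5p2 (suc n) (suc t) (s≤s 1≤n) _ =
  twistedColouring n (suc t) , twistedColouring-balanced {suc n * suc t} n (suc t) ,
  λ (M , perfect , balanced) →
    -- `t + n * suc t` is the predecessor of the part size `suc n * suc t`; it exposes the first
    -- row.
    1+n≢1 1≤n (numberOfColours≡1 {n} {suc t} {t + n * suc t} perfect balanced)
  where
  1+n≢1 : ∀ {n} → 1 ≤ n → suc n ≢ 1
  1+n≢1 (s≤s _) ()
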